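{- Let a logic be given by a sentential language with a constant expressive semantics over a finite set $V$ of truth values, whose consequence relation is induced by an intersective mixed consequence truth-relation $\models$, and suppose the logic has a G-conditional. Then for every classical connective $C$ (a truth function $\{0,1\}^n\to\{0,1\}$), there is a truth function $\underline{C^+}:V^n\to V$ such that a connective $C^+$ interpreted by it is regular for the logic with a regularity rule $(\mathcal{B}^p,\mathcal{B}^c)$ that is also satisfied by $C$ in classical logic.
   Context: Truth values: finite $V$ containing distinct $1,0$. A set of designated values is $\mathcal{D}\subseteq V$ with $1\in\mathcal{D}$, $0\notin\mathcal{D}$; the mixed truth-relation $\models_{\mathcal{D}_p,\mathcal{D}_c}$ holds between $\gamma,\delta\subseteq V$ iff ($\gamma\subseteq\mathcal{D}_p\Rightarrow\delta\cap\mathcal{D}_c\neq\emptyset$); an intersective mixed truth-relation is a finite intersection of such. A sentential language has denumerably many atoms and connectives; a semantics is a set of valuations mapping atoms to $V$, interpreting each $n$-ary connective by a fixed truth function $V^n\to V$ (same for all valuations), extended compositionally, and such that every assignment of values to finitely many distinct atoms is realized by some valuation. The induced consequence relation on sets of formulas: $\Gamma\vdash\Delta$ iff $v(\Gamma)\models v(\Delta)$ for every valuation $v$. Constant expressive: for every $\alpha\in V$ some formula has value $\alpha$ under every valuation. Write $\Gamma,A$ for $\Gamma\cup\{A\}$. An $n$-ary connective $C$ is regular with regularity rule $(\mathcal{B}^p,\mathcal{B}^c)$, $\mathcal{B}^p,\mathcal{B}^c\subseteq\mathcal{P}(\{1..n\})^2$, if for all $\Gamma,\Delta,F_1,\dots,F_n$: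 $\Gamma,C(F_1,\dots,F_n)\vdash\Delta$ iff for all $(B_p,B_c)\in\mathcal{B}^p$, $\Gamma\cup\{F_i:i\in B_p\}\vdash\{F_i:i\in B_c\}\cup\Delta$; and $\Gamma\vdash C(F_1,\dots,F_n),\Delta$ iff the same holds for all $(B_p,B_c)\in\mathcal{B}^c$. A G-conditional $\to$ is a binary connective with: $\Gamma\vdash A\to B,\Delta$ iff $\Gamma,A\vdash B,\Delta$; and $\Gamma,A\to B\vdash\Delta$ iff ($\Gamma\vdash A,\Delta$ and $\Gamma,B\vdash\Delta$). Classical logic: $V=\{0,1\}$ with the truth-relation $\models_{\{1\},\{1\}}$. -}

module Defs where

open import Data.Bool.Base using (Bool; true; false)
open import Data.Fin.Base using (Fin)
open import Data.Fin.Properties using (2↔Bool)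
open import Data.Fin.Subset as Sub using (Subset)
open import Data.List.Base using (List)
import Data.List.Membership.Propositional as List
open import Data.Nat.Base using (ℕ; zero; suc)
open import Data.Nat.Properties using (suc-injective)
open import Data.Product.Base using (Σ; ∃; ∃-syntax; _×_; _,_)
open import Data.Vec.Base using (Vec; []; _∷_; lookup)
open import Function.Base using (_∘_)
open import Function.Bundles using (_↔_; _↣_; _⇔_; mk↣; module Injection)
open import Function.Definitions using (Injective)
open import Function.Properties.Inverse using (↔-sym)
open import Level using (0ℓ)
open import Relation.Binary.Core using (REL)
open import Relation.Binary.PropositionalEquality using (_≡_; _≢_; refl; cong)
open import Relation.Unary using (Pred; _∈_; _∉_; _⊆_; _∪_; ｛_｝; _≬_)

------------------------------------------------------------------------
-- Truth values and truth-relations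

record TruthValues : Set₁ where
  field
    Value  : Set
    size   : ℕ
    finite : Value ↔ Fin size
    𝟏 𝟎    : Value
    𝟏≢𝟎    : 𝟏 ≢ 𝟎

open TruthValues public using (Value)

TruthFunction : TruthValues → ℕ → Set
TruthFunction V n = Vec (Value V) n → Value V

TruthRelation : TruthValues → Set₁
TruthRelation V = REL (Pred (Value V) 0ℓ) (Pred (Value V) 0ℓ) 0ℓ

record DesignatedValues (V : TruthValues) : Set₁ where
  open TruthValues V using (𝟏; 𝟎)
  field
    𝒟   : Pred (Value V) 0ℓ
    𝟏∈𝒟 : 𝟏 ∈ 𝒟
    𝟎∉𝒟 : 𝟎 ∉ 𝒟

open DesignatedValues public using (𝒟)

-- δ ≬ 𝒟 states that δ and 𝒟 have a common element.
mixed : ∀ {V} → DesignatedValues V → DesignatedValues V → TruthRelation V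
mixed Dᵖ Dᶜ γ δ = γ ⊆ 𝒟 Dᵖ → δ ≬ 𝒟 Dᶜ

IsIntersectiveMixed : ∀ {V} → TruthRelation V → Set₁
IsIntersectiveMixed {V} _⊨_ =
  ∃[ k ] Σ (Fin k → DesignatedValues V × DesignatedValues V) λ D →
    ∀ γ δ → (γ ⊨ δ) ⇔ (∀ i → let (Dᵖ , Dᶜ) = D i in mixed Dᵖ Dᶜ γ δ)

------------------------------------------------------------------------
-- Languages and semantics

-- Connective n is the type of n-ary connectives.  There are at most
-- countably many connectives and exactly countably infinitely many atoms.
record Language : Set₁ where
  field
    Atom                  : Set
    atoms-denumerable     : Atom ↔ ℕ
    Connective            : ℕ → Set
    connectives-countable : ∃ Connective ↣ ℕ

open Language public using (Atom; Connective)

data Formula (L : Language) : Set where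
  atom : Atom L → Formula L
  con  : ∀ {n} → Connective L n → Vec (Formula L) n → Formula L

record Semantics (V : TruthValues) (L : Language) : Set₁ where
  field
    interpret  : ∀ {n} → Connective L n → TruthFunction V n
    Valuations : Pred (Atom L → Value V) 0ℓ
    realizable : ∀ {k} (p : Fin k → Atom L) → Injective _≡_ _≡_ p →
                 (α : Fin k → Value V) →
                 ∃[ v ] v ∈ Valuations × (∀ i → v (p i) ≡ α i)

open Semantics public using (interpret; Valuations)

module _ {V : TruthValues} {L : Language} (S : Semantics V L) where

  mutual
    eval : (Atom L → Value V) → Formula L → Value V
    eval v (atom p)   = v p
    eval v (con c Fs) = interpret S c (evals v Fs)

    evals : (Atom L → Value V) → ∀ {n} → Vec (Formula L) n → Vec (Value V) n
    evals v []       = []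
    evals v (F ∷ Fs) = eval v F ∷ evals v Fs

  valuesOf : (Atom L → Value V) → Pred (Formula L) 0ℓ → Pred (Value V) 0ℓ
  valuesOf v Γ α = ∃[ F ] F ∈ Γ × eval v F ≡ α

  ConstantExpressive : Set
  ConstantExpressive =
    ∀ α → ∃[ F ] (∀ v → v ∈ Valuations S → eval v F ≡ α)

  Consequence : TruthRelation V → REL (Pred (Formula L) 0ℓ) (Pred (Formula L) 0ℓ) 0ℓ
  Consequence _⊨_ Γ Δ = ∀ v → v ∈ Valuations S → valuesOf v Γ ⊨ valuesOf v Δ

------------------------------------------------------------------------
-- Regular connectives and G-conditionals

-- The lists stand for the finite sets of their members: only membership is
-- ever used.
record RegularityRule (n : ℕ) : Set where
  constructor _,ʳ_
  field
    ℬᵖ ℬᶜ : List (Subset n × Subset n)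

_⟨_⟩ : ∀ {L n} → Vec (Formula L) n → Subset n → Pred (Formula L) 0ℓ
(Fs ⟨ B ⟩) G = ∃[ i ] i Sub.∈ B × lookup Fs i ≡ G

module _ {V : TruthValues} {L : Language}
         (S : Semantics V L) (_⊨_ : TruthRelation V) where

  private
    infix 4 _⊢_
    _⊢_ : REL (Pred (Formula L) 0ℓ) (Pred (Formula L) 0ℓ) 0ℓ
    _⊢_ = Consequence S _⊨_

  IsRegular : ∀ {n} → Connective L n → RegularityRule n → Set₁
  IsRegular c (ℬᵖ ,ʳ ℬᶜ) = ∀ Γ Δ Fs →
    ((Γ ∪ ｛ con c Fs ｝ ⊢ Δ) ⇔
      (∀ Bᵖ Bᶜ → (Bᵖ , Bᶜ) List.∈ ℬᵖ → Γ ∪ Fs ⟨ Bᵖ ⟩ ⊢ Fs ⟨ Bᶜ ⟩ ∪ Δ)) ×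
    ((Γ ⊢ ｛ con c Fs ｝ ∪ Δ) ⇔
      (∀ Bᵖ Bᶜ → (Bᵖ , Bᶜ) List.∈ ℬᶜ → Γ ∪ Fs ⟨ Bᵖ ⟩ ⊢ Fs ⟨ Bᶜ ⟩ ∪ Δ))

  IsGConditional : Connective L 2 → Set₁
  IsGConditional c = ∀ Γ Δ A B → let A→B = con c (A ∷ B ∷ []) in
    ((Γ ⊢ ｛ A→B ｝ ∪ Δ) ⇔ (Γ ∪ ｛ A ｝ ⊢ ｛ B ｝ ∪ Δ)) ×
    ((Γ ∪ ｛ A→B ｝ ⊢ Δ) ⇔ ((Γ ⊢ ｛ A ｝ ∪ Δ) × (Γ ∪ ｛ B ｝ ⊢ Δ)))

  HasGConditional : Set₁
  HasGConditional = ∃ IsGConditional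

------------------------------------------------------------------------
-- Adding a connective to a language

data WithNew (C : ℕ → Set) (n : ℕ) : ℕ → Set where
  new : WithNew C n n
  old : ∀ {m} → C m → WithNew C n m

adjoin : Language → ℕ → Language
adjoin L n = record
  { Atom                  = Atom L
  ; atoms-denumerable     = Language.atoms-denumerable L
  ; Connective            = WithNew (Connective L) n
  ; connectives-countable = mk↣ code-injective
  }
  where
  open Injection (Language.connectives-countable L) using (to; injective)

  code : ∃ (WithNew (Connective L) n) → ℕ
  code (_ , new)   = zero
  code (_ , old c) = suc (to (_ , c))

  code-injective : Injective _≡_ _≡_ code
  code-injective {_ , new}   {_ , new}   _  = refl
  code-injective {_ , old _} {_ , old _} eq =
    cong (λ (m , c) → m , old c) (injective (suc-injective eq))

infixl 5 _⊕_

_⊕_ : ∀ {V L n} → Semantics V L → TruthFunction V n → Semantics V (adjoin L n)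
S ⊕ f = record
  { interpret  = λ { new → f ; (old c) → interpret S c }
  ; Valuations = Valuations S
  ; realizable = Semantics.realizable S
  }

-- A connective interpreted by f is regular for the logic: the logic is
-- considered in its language enriched with such a connective, so Γ, Δ and
-- the arguments range over formulas that may themselves contain it.
IsRegularTruthFunction : ∀ {V L n} → Semantics V L → TruthRelation V →
                         TruthFunction V n → RegularityRule n → Set₁
IsRegularTruthFunction S _⊨_ f = IsRegular (S ⊕ f) _⊨_ new

------------------------------------------------------------------------
-- Classical logic

boolean : TruthValues
boolean = record
  { Value  = Bool
  ; size   = 2
  ; finite = ↔-sym 2↔Bool
  ; 𝟏      = true
  ; 𝟎      = false
  ; 𝟏≢𝟎    = λ ()
  }

onlyTrue : DesignatedValues boolean
onlyTrue = record { 𝒟 = ｛ true ｝ ; 𝟏∈𝒟 = refl ; 𝟎∉𝒟 = λ () }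

classical : TruthRelation boolean
classical = mixed onlyTrue onlyTrue

-- No choice of classical vocabulary is made: the rule must hold whatever
-- the two-valued language and semantics to which C belongs.
IsClassicalRule : ∀ {n} → TruthFunction boolean n → RegularityRule n → Set₁
IsClassicalRule C r = ∀ {L} (S : Semantics boolean L) →
                      IsRegularTruthFunction S classical C r

{-# OPTIONS --safe #-}
-- Constant expressivity turns the two rules of the G-conditional into laws of
-- the truth-relation itself, quantified over sets of truth values.  Since 𝟎
-- never is designated, every term t built from variables, 𝟎 and → is then
-- regular: unfolding → and 𝟎 on either side of the turnstile computes a rule
-- which depends on t only.  No other structural rule than weakening is used
-- (reflexivity and cut may fail), so the rule is read off the term and not off
-- its truth table.  Classical logic is itself an instance, where → and 𝟎
-- express every truth function, so the term and its rule serve both logics.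
module Submission where

open import Defs
open import Data.Bool.Base using (Bool; true; false; not; _∨_)
open import Data.Fin.Base using (Fin; zero; suc)
open import Data.Fin.Subset as Sub using (Subset; ⁅_⁆)
open import Data.Fin.Subset.Properties
  using (∉⊥; x∈⁅x⁆; x∈⁅y⁆⇒x≡y; x∈p∪q⁺; x∈p∪q⁻)
open import Data.List.Base using (List; []; _∷_; [_]; _++_; cartesianProductWith)
import Data.List.Membership.Propositional as List
open import Data.List.Membership.Propositional.Properties
  using (∈-++⁺ˡ; ∈-++⁺ʳ; ∈-++⁻; ∈-cartesianProductWith⁺; ∈-cartesianProductWith⁻)
open import Data.List.Relation.Unary.Any using (here)
open import Data.Nat.Base using (ℕ; zero; suc)
open import Data.Product.Base using (Σ; ∃; _×_; _,_; proj₁; proj₂)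
open import Data.Sum.Base as Sum using (_⊎_; inj₁; inj₂; [_,_]′)
open import Data.Vec.Base using (Vec; []; _∷_; lookup; map; tabulate)
open import Data.Vec.Properties using (tabulate-∘; tabulate∘lookup)
open import Function.Base using (_∘_; id; case_of_)
open import Function.Bundles using (_⇔_; mk⇔; module Equivalence)
open import Level using (0ℓ)
open import Relation.Binary.PropositionalEquality
  using (_≡_; refl; sym; trans; cong; cong₂; subst)
open import Relation.Nullary.Negation using (contradiction)
open import Relation.Unary using (Pred; _∈_; _⊆_; _≐_; _∪_; ｛_｝)
open import Relation.Unary.Properties using (≐-refl)

open Equivalence using (to; from)
open TruthValues using (𝟎)

-- Terms over falsum and implication, and the rules read off them.

data Term (n : ℕ) : Set where
  var : Fin n → Term n
  ⊥   : Term n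
  _⇒_ : Term n → Term n → Term n

infixr 5 _⇒_

private
  variable
    n : ℕ

⟦_⟧ : Term n → (V : TruthValues) → TruthFunction V 2 → TruthFunction V n
⟦ var i ⟧ V cond xs = lookup xs i
⟦ ⊥ ⟧     V cond xs = 𝟎 V
⟦ s ⇒ t ⟧ V cond xs = cond (⟦ s ⟧ V cond xs ∷ ⟦ t ⟧ V cond xs ∷ [])

_∪ₚ_ : Subset n × Subset n → Subset n × Subset n → Subset n × Subset n
(p , c) ∪ₚ (p′ , c′) = (p Sub.∪ p′) , (c Sub.∪ c′)

mutual
  ℬᵖ : Term n → List (Subset n × Subset n)
  ℬᵖ (var i) = [ ⁅ i ⁆ , Sub.⊥ ]
  -- A falsum among the premises leaves nothing to check. Among the conclusions it is merely
  -- dropped, hence the single premise in `ℬᶜ` that adds nothing to the context.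
  ℬᵖ ⊥       = []
  ℬᵖ (s ⇒ t) = ℬᶜ s ++ ℬᵖ t

  ℬᶜ : Term n → List (Subset n × Subset n)
  ℬᶜ (var i) = [ Sub.⊥ , ⁅ i ⁆ ]
  ℬᶜ ⊥       = [ Sub.⊥ , Sub.⊥ ]
  -- An implication among the conclusions puts `s` on the left and `t` on the right of one and the
  -- same sequent, so each premise for the one is merged with each premise for the other.
  ℬᶜ (s ⇒ t) = cartesianProductWith _∪ₚ_ (ℬᵖ s) (ℬᶜ t)

rule : Term n → RegularityRule n
rule t = ℬᵖ t ,ʳ ℬᶜ t

module _ {A : Set} where

  -- Counterpart of `_⟨_⟩` for values, so that rules can be stated about the truth-relation itself.
  _⟪_⟫ : Vec A n → Subset n → Pred A 0ℓ
  (xs ⟪ B ⟫) a = Σ (Fin _) λ i → i Sub.∈ B × lookup xs i ≡ a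

  ⟪⟫-⊥ : (xs : Vec A n) {a : A} {P : Set} → a ∈ xs ⟪ Sub.⊥ ⟫ → P
  ⟪⟫-⊥ xs (_ , i∈⊥ , _) = contradiction i∈⊥ ∉⊥

  ⟪⟫-⁅⁆ : (xs : Vec A n) (i : Fin n) → xs ⟪ ⁅ i ⁆ ⟫ ≐ ｛ lookup xs i ｝
  ⟪⟫-⁅⁆ xs i =
    (λ (j , j∈⁅i⁆ , eq) → trans (cong (lookup xs) (sym (x∈⁅y⁆⇒x≡y i j∈⁅i⁆))) eq) ,
    (λ eq → i , x∈⁅x⁆ i , eq)

  ⟪⟫-∪ : (xs : Vec A n) (B B′ : Subset n) →
         xs ⟪ B Sub.∪ B′ ⟫ ≐ xs ⟪ B ⟫ ∪ xs ⟪ B′ ⟫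
  ⟪⟫-∪ xs B B′ =
    (λ (i , i∈B∪B′ , eq) → Sum.map (λ i∈ → i , i∈ , eq) (λ i∈ → i , i∈ , eq) (x∈p∪q⁻ B B′ i∈B∪B′)) ,
    [ (λ (i , i∈B , eq) → i , x∈p∪q⁺ (inj₁ i∈B) , eq)
    , (λ (i , i∈B′ , eq) → i , x∈p∪q⁺ (inj₂ i∈B′) , eq) ]′

-- Laws of an intersective mixed truth-relation.

module IntersectiveMixed {V : TruthValues} (_⊨_ : TruthRelation V)
                         (isIM : IsIntersectiveMixed {V} _⊨_) where

  infix 4 _⊢_
  _⊢_ : TruthRelation V
  _⊢_ = _⊨_

  private
    D = proj₁ (proj₂ isIM)
    ⊢⇔mixed = proj₂ (proj₂ isIM)

    variable
      γ γ′ δ δ′ : Pred (Value V) 0ℓ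

  -- In each mixed component a larger `γ` only strengthens the hypothesis, and a larger `δ` keeps
  -- the designated witness.
  weaken : γ ⊆ γ′ → δ ⊆ δ′ → γ ⊢ δ → γ′ ⊢ δ′
  weaken γ⊆γ′ δ⊆δ′ γ⊢δ = from (⊢⇔mixed _ _) λ i γ′⊆𝒟 →
    let (α , α∈δ , α∈𝒟) = to (⊢⇔mixed _ _) γ⊢δ i (γ′⊆𝒟 ∘ γ⊆γ′)
    in α , δ⊆δ′ α∈δ , α∈𝒟

  ⊢-cong : γ ≐ γ′ → δ ≐ δ′ → (γ ⊢ δ) ⇔ (γ′ ⊢ δ′)
  ⊢-cong (γ⊆ , γ⊇) (δ⊆ , δ⊇) = mk⇔ (weaken γ⊆ δ⊆) (weaken γ⊇ δ⊇)

  𝟎-left : γ ∪ ｛ 𝟎 V ｝ ⊢ δ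
  𝟎-left = from (⊢⇔mixed _ _) λ i ⊆𝒟 →
    contradiction (⊆𝒟 (inj₂ refl)) (DesignatedValues.𝟎∉𝒟 (proj₁ (D i)))

  𝟎-right : γ ⊢ ｛ 𝟎 V ｝ ∪ δ → γ ⊢ δ
  𝟎-right γ⊢𝟎,δ = from (⊢⇔mixed _ _) λ i γ⊆𝒟 →
    case to (⊢⇔mixed _ _) γ⊢𝟎,δ i γ⊆𝒟 of λ where
      (_ , inj₁ refl , 𝟎∈𝒟) → contradiction 𝟎∈𝒟 (DesignatedValues.𝟎∉𝒟 (proj₂ (D i)))
      (α , inj₂ α∈δ , α∈𝒟)  → α , α∈δ , α∈𝒟

  Premises : List (Subset n × Subset n) → Vec (Value V) n → TruthRelation V
  Premises ℬ xs γ δ =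
    ∀ Bᵖ Bᶜ → (Bᵖ , Bᶜ) List.∈ ℬ → γ ∪ xs ⟪ Bᵖ ⟫ ⊢ xs ⟪ Bᶜ ⟫ ∪ δ

  Premises-[] : ∀ Bᵖ Bᶜ (xs : Vec (Value V) n) →
                Premises [ Bᵖ , Bᶜ ] xs γ δ ⇔ (γ ∪ xs ⟪ Bᵖ ⟫ ⊢ xs ⟪ Bᶜ ⟫ ∪ δ)
  Premises-[] Bᵖ Bᶜ xs = mk⇔
    (λ ps → ps Bᵖ Bᶜ (here refl))
    (λ { p _ _ (here refl) → p })

  Premises-++ : ∀ ℬ ℬ′ (xs : Vec (Value V) n) →
                Premises (ℬ ++ ℬ′) xs γ δ ⇔ (Premises ℬ xs γ δ × Premises ℬ′ xs γ δ)
  Premises-++ ℬ ℬ′ xs = mk⇔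
    (λ ps → (λ _ _ B∈ℬ → ps _ _ (∈-++⁺ˡ B∈ℬ)) ,
            (λ _ _ B∈ℬ′ → ps _ _ (∈-++⁺ʳ ℬ B∈ℬ′)))
    (λ (ps , ps′) _ _ B∈ → [ ps _ _ , ps′ _ _ ]′ (∈-++⁻ ℬ B∈))

  -- Merging premises pairwise amounts to applying the second rule in every context that the first
  -- one produces.
  Premises-product : ∀ ℬ ℬ′ (xs : Vec (Value V) n) →
    Premises (cartesianProductWith _∪ₚ_ ℬ ℬ′) xs γ δ ⇔
    (∀ Bᵖ Bᶜ → (Bᵖ , Bᶜ) List.∈ ℬ → Premises ℬ′ xs (γ ∪ xs ⟪ Bᵖ ⟫) (xs ⟪ Bᶜ ⟫ ∪ δ))
  Premises-product {γ = γ} {δ = δ} ℬ ℬ′ xs = mk⇔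
    (λ ps Bᵖ Bᶜ B∈ℬ Bᵖ′ Bᶜ′ B′∈ℬ′ →
      to (regroup Bᵖ Bᶜ Bᵖ′ Bᶜ′) (ps _ _ (∈-cartesianProductWith⁺ _∪ₚ_ B∈ℬ B′∈ℬ′)))
    (λ ps _ _ B∈ → case ∈-cartesianProductWith⁻ _∪ₚ_ ℬ ℬ′ B∈ of λ where
      ((Bᵖ , Bᶜ) , (Bᵖ′ , Bᶜ′) , B∈ℬ , B′∈ℬ′ , refl) →
        from (regroup Bᵖ Bᶜ Bᵖ′ Bᶜ′) (ps _ _ B∈ℬ _ _ B′∈ℬ′))
    where
    regroup : ∀ Bᵖ Bᶜ Bᵖ′ Bᶜ′ →
      (γ ∪ xs ⟪ Bᵖ Sub.∪ Bᵖ′ ⟫ ⊢ xs ⟪ Bᶜ Sub.∪ Bᶜ′ ⟫ ∪ δ) ⇔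
      ((γ ∪ xs ⟪ Bᵖ ⟫) ∪ xs ⟪ Bᵖ′ ⟫ ⊢ xs ⟪ Bᶜ′ ⟫ ∪ xs ⟪ Bᶜ ⟫ ∪ δ)
    regroup Bᵖ Bᶜ Bᵖ′ Bᶜ′ = ⊢-cong
      ( Sum.assocˡ ∘ Sum.map₂ (proj₁ (⟪⟫-∪ xs Bᵖ Bᵖ′))
      , Sum.map₂ (proj₂ (⟪⟫-∪ xs Bᵖ Bᵖ′)) ∘ Sum.assocʳ )
      -- The swap is due to the second rule, which puts its conclusions in front of those of the
      -- first.
      ( Sum.assocʳ ∘ Sum.map₁ (Sum.swap ∘ proj₁ (⟪⟫-∪ xs Bᶜ Bᶜ′))
      , Sum.map₁ (proj₂ (⟪⟫-∪ xs Bᶜ Bᶜ′) ∘ Sum.swap) ∘ Sum.assocˡ )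

  -- Regularity of every term at the level of truth values.

  IsConditional : TruthFunction V 2 → Set₁
  IsConditional cond = ∀ γ δ α β → let α⟶β = cond (α ∷ β ∷ []) in
    ((γ ⊢ ｛ α⟶β ｝ ∪ δ) ⇔ (γ ∪ ｛ α ｝ ⊢ ｛ β ｝ ∪ δ)) ×
    ((γ ∪ ｛ α⟶β ｝ ⊢ δ) ⇔ ((γ ⊢ ｛ α ｝ ∪ δ) × (γ ∪ ｛ β ｝ ⊢ δ)))

  module _ (cond : TruthFunction V 2) (isConditional : IsConditional cond) where

    mutual
      -- Induction on `t`, simultaneous with `right-rule` because the antecedent of an implication
      -- changes sides. The contexts stay general since they grow along the way.
      left-rule : (t : Term n) (xs : Vec (Value V) n) →
                  (γ ∪ ｛ ⟦ t ⟧ V cond xs ｝ ⊢ δ) ⇔ Premises (ℬᵖ t) xs γ δ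
      left-rule (var i) xs = mk⇔
        (from (Premises-[] _ _ xs) ∘ weaken (Sum.map₂ (proj₂ (⟪⟫-⁅⁆ xs i))) inj₂)
        (weaken (Sum.map₂ (proj₁ (⟪⟫-⁅⁆ xs i))) [ ⟪⟫-⊥ xs , id ]′ ∘ to (Premises-[] _ _ xs))
      left-rule ⊥ xs = mk⇔ (λ _ _ _ ()) (λ _ → 𝟎-left)
      left-rule {γ = γ} {δ = δ} (s ⇒ t) xs = mk⇔
        (λ s⇒t⊢δ → let (⊢s,δ , t⊢δ) = to (proj₂ (isConditional γ δ _ _)) s⇒t⊢δ in
          from (Premises-++ (ℬᶜ s) (ℬᵖ t) xs)
            (to (right-rule s xs) ⊢s,δ , to (left-rule t xs) t⊢δ))
        (λ ps → let (psˢ , psᵗ) = to (Premises-++ (ℬᶜ s) (ℬᵖ t) xs) ps in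
          from (proj₂ (isConditional γ δ _ _))
            (from (right-rule s xs) psˢ , from (left-rule t xs) psᵗ))

      right-rule : (t : Term n) (xs : Vec (Value V) n) →
                   (γ ⊢ ｛ ⟦ t ⟧ V cond xs ｝ ∪ δ) ⇔ Premises (ℬᶜ t) xs γ δ
      right-rule (var i) xs = mk⇔
        (from (Premises-[] _ _ xs) ∘ weaken inj₁ (Sum.map₁ (proj₂ (⟪⟫-⁅⁆ xs i))))
        (weaken [ id , ⟪⟫-⊥ xs ]′ (Sum.map₁ (proj₁ (⟪⟫-⁅⁆ xs i))) ∘ to (Premises-[] _ _ xs))
      right-rule ⊥ xs = mk⇔
        (from (Premises-[] _ _ xs) ∘ weaken inj₁ inj₂ ∘ 𝟎-right)
        (weaken [ id , ⟪⟫-⊥ xs ]′ [ ⟪⟫-⊥ xs , inj₂ ]′ ∘ to (Premises-[] _ _ xs))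
      right-rule {γ = γ} {δ = δ} (s ⇒ t) xs = mk⇔
        -- While `s` is unfolded on the left, the value of `t` waits among the conclusions. Each
        -- resulting premise has it behind the new conclusions, and `exchange` brings it to the
        -- front to be unfolded in turn.
        (λ ⊢s⇒t,δ → from (Premises-product (ℬᵖ s) (ℬᶜ t) xs) λ Bᵖ Bᶜ B∈ →
          to (right-rule t xs)
            (weaken id exchange
              (to (left-rule s xs) (to (proj₁ (isConditional γ δ _ _)) ⊢s⇒t,δ) Bᵖ Bᶜ B∈)))
        (λ ps → from (proj₁ (isConditional γ δ _ _))
          (from (left-rule s xs) λ Bᵖ Bᶜ B∈ →
            weaken id exchange
              (from (right-rule t xs) (to (Premises-product (ℬᵖ s) (ℬᶜ t) xs) ps Bᵖ Bᶜ B∈))))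
        where
        exchange : {P Q R : Set} → P ⊎ Q ⊎ R → Q ⊎ P ⊎ R
        exchange = [ inj₂ ∘ inj₁ , Sum.map₂ inj₂ ]′

-- Passage between formulas and their values.

module _ {V : TruthValues} {L : Language} (S : Semantics V L) (v : Atom L → Value V) where

  private
    variable
      Γ Δ : Pred (Formula L) 0ℓ
      γ δ : Pred (Value V) 0ℓ

  valuesOf-∪ : valuesOf S v Γ ≐ γ → valuesOf S v Δ ≐ δ → valuesOf S v (Γ ∪ Δ) ≐ γ ∪ δ
  valuesOf-∪ (Γ⊆ , Γ⊇) (Δ⊆ , Δ⊇) =
    (λ { (F , inj₁ F∈Γ , eq) → inj₁ (Γ⊆ (F , F∈Γ , eq))
       ; (F , inj₂ F∈Δ , eq) → inj₂ (Δ⊆ (F , F∈Δ , eq)) }) ,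
    [ (λ α∈γ → let (F , F∈Γ , eq) = Γ⊇ α∈γ in F , inj₁ F∈Γ , eq)
    , (λ α∈δ → let (F , F∈Δ , eq) = Δ⊇ α∈δ in F , inj₂ F∈Δ , eq) ]′

  valuesOf-｛｝ : ∀ {F α} → eval S v F ≡ α → valuesOf S v ｛ F ｝ ≐ ｛ α ｝
  valuesOf-｛｝ {F} refl = (λ { (_ , refl , eq) → eq }) , (λ eq → F , refl , eq)

  lookup-evals : (Fs : Vec (Formula L) n) (i : Fin n) →
                 lookup (evals S v Fs) i ≡ eval S v (lookup Fs i)
  lookup-evals (F ∷ Fs) zero    = refl
  lookup-evals (F ∷ Fs) (suc i) = lookup-evals Fs i

  valuesOf-⟨⟩ : (Fs : Vec (Formula L) n) (B : Subset n) →
                valuesOf S v (Fs ⟨ B ⟩) ≐ evals S v Fs ⟪ B ⟫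
  valuesOf-⟨⟩ Fs B =
    (λ { (_ , (i , i∈B , refl) , eq) → i , i∈B , trans (lookup-evals Fs i) eq }) ,
    (λ (i , i∈B , eq) →
      lookup Fs i , (i , i∈B , refl) , trans (sym (lookup-evals Fs i)) eq)

module _ {V : TruthValues} (_⊨_ : TruthRelation V) (isIM : IsIntersectiveMixed {V} _⊨_) where

  open IntersectiveMixed _⊨_ isIM

  -- The rule is the same under all valuations, so the value-level equivalences apply to one
  -- valuation at a time. Taking `cond` as a truth function rather than a connective of `L` covers
  -- classical languages without an implication.
  term-regular : ∀ {cond} → IsConditional cond → {f : TruthFunction V n} (t : Term n) →
                 (∀ xs → f xs ≡ ⟦ t ⟧ V cond xs) →
                 ∀ {L} (S : Semantics V L) → IsRegularTruthFunction S _⊨_ f (rule t)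
  term-regular {cond = cond} isConditional {f} t f≡t {L} S Γ Δ Fs =
    mk⇔
      (λ C⊢Δ Bᵖ Bᶜ B∈ v v∈ → from (premise v Bᵖ Bᶜ)
        (to (left-rule cond isConditional t (xs v)) (to (left v) (C⊢Δ v v∈)) Bᵖ Bᶜ B∈))
      (λ ps v v∈ → from (left v) (from (left-rule cond isConditional t (xs v))
        λ Bᵖ Bᶜ B∈ → to (premise v Bᵖ Bᶜ) (ps Bᵖ Bᶜ B∈ v v∈))) ,
    mk⇔
      (λ ⊢C,Δ Bᵖ Bᶜ B∈ v v∈ → from (premise v Bᵖ Bᶜ)
        (to (right-rule cond isConditional t (xs v)) (to (right v) (⊢C,Δ v v∈)) Bᵖ Bᶜ B∈))
      (λ ps v v∈ → from (right v) (from (right-rule cond isConditional t (xs v))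
        λ Bᵖ Bᶜ B∈ → to (premise v Bᵖ Bᶜ) (ps Bᵖ Bᶜ B∈ v v∈)))
    where
    S⁺ = S ⊕ f
    C = con new Fs

    module _ (v : Atom L → Value V) where
      xs = evals S⁺ v Fs
      γ = valuesOf S⁺ v Γ
      δ = valuesOf S⁺ v Δ
      α = ⟦ t ⟧ V cond xs

      left : (valuesOf S⁺ v (Γ ∪ ｛ C ｝) ⊢ δ) ⇔ (γ ∪ ｛ α ｝ ⊢ δ)
      left = ⊢-cong (valuesOf-∪ S⁺ v {Γ} {γ} ≐-refl (valuesOf-｛｝ S⁺ v (f≡t xs))) ≐-refl

      right : (γ ⊢ valuesOf S⁺ v (｛ C ｝ ∪ Δ)) ⇔ (γ ⊢ ｛ α ｝ ∪ δ)
      right = ⊢-cong ≐-refl (valuesOf-∪ S⁺ v {｛ C ｝} {｛ α ｝} (valuesOf-｛｝ S⁺ v (f≡t xs)) ≐-refl)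

      premise : ∀ Bᵖ Bᶜ → (valuesOf S⁺ v (Γ ∪ Fs ⟨ Bᵖ ⟩) ⊢ valuesOf S⁺ v (Fs ⟨ Bᶜ ⟩ ∪ Δ)) ⇔
                          (γ ∪ xs ⟪ Bᵖ ⟫ ⊢ xs ⟪ Bᶜ ⟫ ∪ δ)
      premise Bᵖ Bᶜ = ⊢-cong
        (valuesOf-∪ S⁺ v {Γ} {γ} ≐-refl (valuesOf-⟨⟩ S⁺ v Fs Bᵖ))
        (valuesOf-∪ S⁺ v (valuesOf-⟨⟩ S⁺ v Fs Bᶜ) ≐-refl)

  -- Every set γ of truth values is the set of values of the formulas Const γ
  -- under all valuations.
  interpret-conditional : ∀ {L} (S : Semantics V L) → ConstantExpressive S →
                          (c : Connective L 2) → IsGConditional S _⊨_ c →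
                          IsConditional (interpret S c)
  interpret-conditional {L} S constant c isG γ δ α β =
    mk⇔
      (λ h → lower (∪-≈ (Const-≈ γ) α-≈) (∪-≈ β-≈ (Const-≈ δ))
        (to (proj₁ G) (lift (Const-≈ γ) (∪-≈ α⟶β-≈ (Const-≈ δ)) h)))
      (λ h → lower (Const-≈ γ) (∪-≈ α⟶β-≈ (Const-≈ δ))
        (from (proj₁ G) (lift (∪-≈ (Const-≈ γ) α-≈) (∪-≈ β-≈ (Const-≈ δ)) h))) ,
    mk⇔
      (λ h → let (h₁ , h₂) = to (proj₂ G) (lift (∪-≈ (Const-≈ γ) α⟶β-≈) (Const-≈ δ) h) in
        lower (Const-≈ γ) (∪-≈ α-≈ (Const-≈ δ)) h₁ , lower (∪-≈ (Const-≈ γ) β-≈) (Const-≈ δ) h₂)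
      (λ (h₁ , h₂) → lower (∪-≈ (Const-≈ γ) α⟶β-≈) (Const-≈ δ) (from (proj₂ G)
        (lift (Const-≈ γ) (∪-≈ α-≈ (Const-≈ δ)) h₁ , lift (∪-≈ (Const-≈ γ) β-≈) (Const-≈ δ) h₂)))
    where
    k : Value V → Formula L
    k α = proj₁ (constant α)

    infix 4 _≈_
    -- For sets whose values do not vary with the valuation, consequence comes down to a single
    -- instance of the truth-relation. This is what `lift` and `lower` exploit.
    record _≈_ (Γ : Pred (Formula L) 0ℓ) (γ : Pred (Value V) 0ℓ) : Set where
      constructor mk≈
      field at : ∀ v → v ∈ Valuations S → valuesOf S v Γ ≐ γ
    open _≈_

    Const : Pred (Value V) 0ℓ → Pred (Formula L) 0ℓ
    Const γ F = ∃ λ α → α ∈ γ × k α ≡ F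

    Const-≈ : ∀ γ → Const γ ≈ γ
    Const-≈ γ .at v v∈ =
      (λ { (_ , (α , α∈γ , refl) , eq) → subst γ (trans (sym (proj₂ (constant α) v v∈)) eq) α∈γ }) ,
      (λ {α} α∈γ → k α , (α , α∈γ , refl) , proj₂ (constant α) v v∈)

    ∪-≈ : ∀ {Γ Δ γ δ} → Γ ≈ γ → Δ ≈ δ → Γ ∪ Δ ≈ γ ∪ δ
    ∪-≈ Γ≈γ Δ≈δ .at v v∈ = valuesOf-∪ S v (at Γ≈γ v v∈) (at Δ≈δ v v∈)

    k-≈ : ∀ {α} → ｛ k α ｝ ≈ ｛ α ｝
    k-≈ {α} .at v v∈ = valuesOf-｛｝ S v (proj₂ (constant α) v v∈)

    α-≈ = k-≈ {α}
    β-≈ = k-≈ {β}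

    α⟶β-≈ : ｛ con c (k α ∷ k β ∷ []) ｝ ≈ ｛ interpret S c (α ∷ β ∷ []) ｝
    α⟶β-≈ .at v v∈ = valuesOf-｛｝ S v (cong₂ (λ a b → interpret S c (a ∷ b ∷ []))
      (proj₂ (constant α) v v∈) (proj₂ (constant β) v v∈))

    lift : ∀ {Γ Δ γ δ} → Γ ≈ γ → Δ ≈ δ → γ ⊢ δ → Consequence S _⊨_ Γ Δ
    lift Γ≈γ Δ≈δ γ⊢δ v v∈ = from (⊢-cong (at Γ≈γ v v∈) (at Δ≈δ v v∈)) γ⊢δ

    -- The case k = 0 of realizability says that some valuation exists.
    lower : ∀ {Γ Δ γ δ} → Γ ≈ γ → Δ ≈ δ → Consequence S _⊨_ Γ Δ → γ ⊢ δ
    lower Γ≈γ Δ≈δ Γ⊢Δ =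
      let (v , v∈ , _) = Semantics.realizable S {0} (λ ()) (λ { {()} }) (λ ())
      in to (⊢-cong (at Γ≈γ v v∈) (at Δ≈δ v v∈)) (Γ⊢Δ v v∈)

    G = isG (Const γ) (Const δ) (k α) (k β)

-- Classical logic as an instance.

classical-isIntersectiveMixed : IsIntersectiveMixed {boolean} classical
classical-isIntersectiveMixed =
  1 , (λ _ → onlyTrue , onlyTrue) , λ _ _ → mk⇔ (λ γ⊨δ _ → γ⊨δ) (λ γ⊨δ → γ⊨δ zero)

implication : TruthFunction boolean 2
implication (a ∷ b ∷ []) = not a ∨ b

open IntersectiveMixed {boolean} classical classical-isIntersectiveMixed
  using (IsConditional)

-- Splitting on the antecedent suffices: the implication then computes to its consequent or to
-- `true`.
implication-isConditional : IsConditional implication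
implication-isConditional γ δ α β =
  mk⇔ (right⁺ α β) (right⁻ α β) , mk⇔ (left⁺ α β) (left⁻ α β)
  where
  _∣_ : Bool → Bool → Bool
  a ∣ b = implication (a ∷ b ∷ [])

  right⁺ : ∀ a b → classical γ (｛ a ∣ b ｝ ∪ δ) → classical (γ ∪ ｛ a ｝) (｛ b ｝ ∪ δ)
  right⁺ true  b h ⊆𝒟 = h (⊆𝒟 ∘ inj₁)
  right⁺ false b h ⊆𝒟 = case ⊆𝒟 (inj₂ refl) of λ ()

  right⁻ : ∀ a b → classical (γ ∪ ｛ a ｝) (｛ b ｝ ∪ δ) → classical γ (｛ a ∣ b ｝ ∪ δ)
  -- Here `id` works because the designated values are by definition the singleton of `true`.
  right⁻ true  b h γ⊆𝒟 = h [ γ⊆𝒟 , id ]′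
  right⁻ false b h γ⊆𝒟 = true , inj₁ refl , refl

  left⁺ : ∀ a b → classical (γ ∪ ｛ a ∣ b ｝) δ → classical γ (｛ a ｝ ∪ δ) × classical (γ ∪ ｛ b ｝) δ
  left⁺ true  b h = (λ _ → true , inj₁ refl , refl) , h
  left⁺ false b h =
    (λ γ⊆𝒟 → let (x , x∈δ , eq) = h [ γ⊆𝒟 , id ]′ in x , inj₂ x∈δ , eq) ,
    (λ ⊆𝒟 → h [ ⊆𝒟 ∘ inj₁ , id ]′)

  left⁻ : ∀ a b → classical γ (｛ a ｝ ∪ δ) × classical (γ ∪ ｛ b ｝) δ → classical (γ ∪ ｛ a ∣ b ｝) δ
  left⁻ true  b (_ , h₂) = h₂
  left⁻ false b (h₁ , _) ⊆𝒟 = case h₁ (⊆𝒟 ∘ inj₁) of λ where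
    (_ , inj₁ refl , ())
    (x , inj₂ x∈δ , eq) → x , x∈δ , eq

-- Functional completeness of implication and falsum.

if_then_else_ : Term n → Term n → Term n → Term n
-- This is the conjunction of `s ⇒ t` and `(s ⇒ ⊥) ⇒ u`, with `p` and `q` conjoined as
-- `(p ⇒ q ⇒ ⊥) ⇒ ⊥`.
if s then t else u = ((s ⇒ t) ⇒ ((s ⇒ ⊥) ⇒ u) ⇒ ⊥) ⇒ ⊥

-- Shannon expansion on the first argument. The arguments are terms in `m` variables, so `m` stays
-- fixed while the arity decreases.
express : ∀ {m} → TruthFunction boolean n → Vec (Term m) n → Term m
express {zero}  C []       with C []
... | true  = ⊥ ⇒ ⊥
... | false = ⊥
express {suc n} C (s ∷ ss) =
  if s then express (C ∘ (true ∷_)) ss else express (C ∘ (false ∷_)) ss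

module _ {m : ℕ} (xs : Vec Bool m) where

  private
    ⟦_⟧ᵇ : Term m → Bool
    ⟦ t ⟧ᵇ = ⟦ t ⟧ boolean implication xs

  if-correct : ∀ s t u (g : Bool → Bool) → ⟦ t ⟧ᵇ ≡ g true → ⟦ u ⟧ᵇ ≡ g false →
               ⟦ if s then t else u ⟧ᵇ ≡ g ⟦ s ⟧ᵇ
  if-correct s t u g eqᵗ eqᵘ with ⟦ s ⟧ᵇ | ⟦ t ⟧ᵇ | ⟦ u ⟧ᵇ
  -- The discarded branch vanishes by computation. The surviving one remains under a double
  -- negation, so its value has to be split too.
  ... | true  | true  | _     = eqᵗ
  ... | true  | false | _     = eqᵗ
  ... | false | _     | true  = eqᵘ
  ... | false | _     | false = eqᵘ

  express-correct : (C : TruthFunction boolean n) (ss : Vec (Term m) n) →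
                    ⟦ express C ss ⟧ᵇ ≡ C (map ⟦_⟧ᵇ ss)
  express-correct {zero} C [] with C []
  ... | true  = refl
  ... | false = refl
  express-correct {suc n} C (s ∷ ss) =
    if-correct s (express (C ∘ (true ∷_)) ss) (express (C ∘ (false ∷_)) ss)
      (λ b → C (b ∷ map ⟦_⟧ᵇ ss))
      (express-correct (C ∘ (true ∷_)) ss) (express-correct (C ∘ (false ∷_)) ss)

functionally-complete : (C : TruthFunction boolean n) →
  ∃ λ t → ∀ xs → C xs ≡ ⟦ t ⟧ boolean implication xs
functionally-complete C = express C (tabulate var) , λ xs →
  sym (trans (express-correct xs C (tabulate var))
    (cong C (trans (sym (tabulate-∘ _ var)) (tabulate∘lookup xs))))

theorem3p19 : (V : TruthValues) (L : Language) (S : Semantics V L) (_⊨_ : TruthRelation V) →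
    IsIntersectiveMixed {V} _⊨_ →
    ConstantExpressive S →
    HasGConditional S _⊨_ →
    (n : ℕ) (C : TruthFunction boolean n) →
    Σ (TruthFunction V n) λ C⁺ → Σ (RegularityRule n) λ r →
    IsRegularTruthFunction S _⊨_ C⁺ r × IsClassicalRule C r
theorem3p19 V L S _⊨_ isIM constant (c , isG) n C =
  -- The term is found from the classical truth table and then reinterpreted in `V` through the
  -- given conditional. Agreement with `C⁺` is thus definitional, while agreement with `C` is `C≡t`.
  let (t , C≡t) = functionally-complete C in
  ⟦ t ⟧ V (interpret S c) , rule t ,
  term-regular _⊨_ isIM (interpret-conditional _⊨_ isIM S constant c isG) t (λ _ → refl) S ,
  term-regular {boolean} classical classical-isIntersectiveMixed implication-isConditional t C≡t
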